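{- Let $a\geq 15$ be an integer, let $\rho$ be the root greater than $a+1$ of $x^3-ax^2-(a+3)x-1$, and let $\gamma=a^2+a+8+(a^2-a+1)\rho+(2-a)\rho^2\in\mathbb{Z}[\rho]$. Let $\alpha\in\blacktriangle_0\cup\{1+\rho+\rho^2\}$. If $N(\alpha^2)\leq N(\gamma)$, then \[ \alpha\in\{ -w\rho+\rho^2 : 1\leq w\leq a\}\cup\{1+\rho+\rho^2,\,-1-(a+4)\rho+2\rho^2\}, \] where $w$ ranges over integers.
   Context: The polynomial $x^3-ax^2-(a+3)x-1$ is irreducible over $\mathbb{Q}$ with three real roots $\rho,\rho',\rho''$, labelled so that $a+1<\rho$, $-2<\rho'<-1$, $-1<\rho''<0$. $N$ denotes the norm from $\mathbb{Q}(\rho)$ to $\mathbb{Q}$, i.e. the product of the three conjugates. For integers $v,W$ with $0\leq v\leq a$ and $0\leq W\leq a-v$, put \[ \alpha(v,W)=-v-(v(a+2)+1+W)\rho+(v+1)\rho^2 . \] Write $a=3A+a_0$ with $A$ an integer and $a_0\in\{0,1,2\}$. The set $\blacktriangle_0=\blacktriangle_0(a)$ is defined (with $v,W$ integers) by \[ \blacktriangle_0=\{\alpha(v,W) : 0\leq v\leq A,\ v\leq W\leq a-2v-1\}\quad\text{if } a_0\in\{1,2\}, \] \[ \blacktriangle_0=\{\alpha(v,W) : 0\leq v\leq A-1,\ v\leq W\leq a-2v-1\}\cup\{\alpha(A,A)\}\quad\text{if } a_0=0. \] -}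

module Defs where

open import Level using (Level; _⊔_; suc)
open import Algebra.Apartness.Bundles using (HeytingCommutativeRing; HeytingField)
open import Algebra.Bundles using (CommutativeRing)
import Algebra.Definitions.RawMonoid as RawMonoidDefs
import Data.Integer as Int
open import Data.Integer using (ℤ; +_; -[1+_])
import Data.Nat as ℕ
open import Data.Product using (_×_; ∃-syntax)
open import Data.Sum using (_⊎_)
open import Relation.Binary.Core using (Rel)
open import Relation.Binary.PropositionalEquality using (_≡_)
open import Relation.Binary.Structures using (IsStrictPartialOrder)
open import Relation.Nullary using (¬_)
open import Relation.Unary using (Pred; _∪_; ｛_｝)

private variable
  c ℓ₁ ℓ₂ : Level

-- The real numbers enter only through the roots below, so an arbitrary ordered
-- field takes their place.  The axioms hold classically in ℝ, with _#_ as _≉_,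
-- and also constructively in the Cauchy or Dedekind reals: equality and order
-- need not be decidable.
record OrderedField c ℓ₁ ℓ₂ : Set (suc (c ⊔ ℓ₁ ⊔ ℓ₂)) where
  infix 4 _<_ _≤_
  field
    heytingField : HeytingField c ℓ₁ ℓ₂

  open HeytingField heytingField public

  commutativeRing : CommutativeRing c ℓ₁
  commutativeRing = HeytingCommutativeRing.commutativeRing heytingCommutativeRing

  field
    _<_                  : Rel Carrier ℓ₂
    isStrictPartialOrder : IsStrictPartialOrder _≈_ _<_
    #⇒<⊎>                : ∀ {x y} → x # y → x < y ⊎ y < x
    <⇒#                  : ∀ {x y} → x < y → x # y
    +-monoˡ-<            : ∀ z {x y} → x < y → x + z < y + z
    *-pos                : ∀ {x y} → 0# < x → 0# < y → 0# < x * y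

  _≤_ : Rel Carrier ℓ₂
  x ≤ y = ¬ (y < x)

module _ (K : OrderedField c ℓ₁ ℓ₂) where
  open OrderedField K
  private module ℕMult = RawMonoidDefs (CommutativeRing.+-rawMonoid commutativeRing)

  fromℤ : ℤ → Carrier
  fromℤ (+ n)    = n ℕMult.× 1#
  fromℤ -[1+ n ] = - (ℕ.suc n ℕMult.× 1#)

  cubic : ℤ → Carrier → Carrier
  cubic a x = x * x * x - fromℤ a * (x * x) - fromℤ (a Int.+ + 3) * x - 1#

  record Roots (a : ℤ) : Set (c ⊔ ℓ₁ ⊔ ℓ₂) where
    field
      ρ ρ′ ρ″ : Carrier
      ρ-root  : cubic a ρ ≈ 0#
      ρ′-root : cubic a ρ′ ≈ 0#
      ρ″-root : cubic a ρ″ ≈ 0#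
      a+1<ρ   : fromℤ (a Int.+ + 1) < ρ
      -2<ρ′   : fromℤ (Int.- (+ 2)) < ρ′
      ρ′<-1   : ρ′ < fromℤ (Int.- (+ 1))
      -1<ρ″   : fromℤ (Int.- (+ 1)) < ρ″
      ρ″<0    : ρ″ < 0#

-- ⟨ p , q , r ⟩ stands for p + qρ + rρ².  Since the cubic is irreducible over ℚ,
-- 1, ρ, ρ² are linearly independent over ℚ, so equality in ℤ[ρ] is equality of
-- coefficients.
record ℤ[ρ] : Set where
  constructor ⟨_,_,_⟩
  field
    coeff₀ coeff₁ coeff₂ : ℤ

scale : ℤ → ℤ[ρ] → ℤ[ρ]
scale k ⟨ p , q , r ⟩ = ⟨ k Int.* p , k Int.* q , k Int.* r ⟩

add : ℤ[ρ] → ℤ[ρ] → ℤ[ρ]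
add ⟨ p , q , r ⟩ ⟨ p′ , q′ , r′ ⟩ = ⟨ p Int.+ p′ , q Int.+ q′ , r Int.+ r′ ⟩

-- Multiplication depends on a through ρ³ = 1 + (a+3)ρ + aρ².
module _ (a : ℤ) where
  open Int using (_+_; _*_)

  ρ·_ : ℤ[ρ] → ℤ[ρ]
  ρ· ⟨ p , q , r ⟩ = ⟨ r , p + (a + + 3) * r , q + a * r ⟩

  mul : ℤ[ρ] → ℤ[ρ] → ℤ[ρ]
  mul ⟨ p , q , r ⟩ y = add (scale p y) (ρ· (add (scale q y) (ρ· (scale r y))))

  square : ℤ[ρ] → ℤ[ρ]
  square x = mul x x

-- The conjugates of an element are its images under the three embeddings
-- ρ ↦ ρ, ρ ↦ ρ′ and ρ ↦ ρ″.
module _ (K : OrderedField c ℓ₁ ℓ₂) {a : ℤ} (R : Roots K a) where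
  open OrderedField K
  open Roots R

  evalAt : Carrier → ℤ[ρ] → Carrier
  evalAt x ⟨ p , q , r ⟩ = fromℤ K p + fromℤ K q * x + fromℤ K r * (x * x)

  norm : ℤ[ρ] → Carrier
  norm α = evalAt ρ α * evalAt ρ′ α * evalAt ρ″ α

module _ (a : ℤ) where
  open Int using (_+_; _-_; _*_; -_; _≤_)

  α⟨_,_⟩ : ℤ → ℤ → ℤ[ρ]
  α⟨ v , W ⟩ = ⟨ - v , - (v * (a + + 2) + + 1 + W) , v + + 1 ⟩

  -- { α(v,W) : 0 ≤ v ≤ n, v ≤ W ≤ a − 2v − 1 }
  rows≤ : ℤ → Pred ℤ[ρ] _
  rows≤ n x = ∃[ v ] ∃[ W ]
    (+ 0 ≤ v × v ≤ n × v ≤ W × W ≤ a - + 2 * v - + 1 × x ≡ α⟨ v , W ⟩)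

  ▲₀ : Pred ℤ[ρ] _
  ▲₀ x = ∃[ A ] ∃[ a₀ ] (a ≡ + 3 * A + a₀ ×
    (((a₀ ≡ + 1 ⊎ a₀ ≡ + 2) × rows≤ A x)
     ⊎ (a₀ ≡ + 0 × (rows≤ (A - + 1) ∪ ｛ α⟨ A , A ⟩ ｝) x)))

  γ : ℤ[ρ]
  γ = ⟨ a * a + a + + 8 , a * a - a + + 1 , + 2 - a ⟩

{-# OPTIONS --safe #-}

-- The cubic has three pairwise apart roots, so Vieta's formulas hold in K and the norm of
-- p + qρ + rρ² is (the image of) an integer form in p, q, r, a.  The hypothesis thus becomes
-- N(α)² ≤ N(γ) in ℤ.  Let B = 3a² + 9a − 37 = N(α(1,2)).  For a = 15 + n the difference
-- B² − N(γ) has positive coefficients in n.  Every α(v,W) with v ≥ 1 other than α(1,1) has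
-- norm at least B: with W = v + s and a = W + 2v + 1 + t, the difference N(α(v,W)) − B has
-- nonnegative coefficients in s, t and the excess of v over its least value, where s = 0 and
-- s ≥ 1 are treated separately.  For α(A,A) with a = 3A, expand around A = 5 instead.
module Submission where

open import Defs
open import Algebra.Bundles using (CommutativeRing; RawRing)
import Algebra.Properties.AbelianGroup as AbelianGroupProperties
import Algebra.Properties.Group as GroupProperties
import Algebra.Properties.Ring as RingProperties
import Algebra.Properties.Semiring.Mult as SemiringMult
import Algebra.Solver.Ring as RingSolver
open import Algebra.Solver.Ring.AlmostCommutativeRing
  using (AlmostCommutativeRing; Induced-equivalence; _-Raw-AlmostCommutative⟶_;
         -raw-almostCommutative⟶; fromCommutativeRing)
open import Data.Fin.Patterns using (0F; 1F; 2F; 3F; 4F; 5F)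
open import Data.Integer using (ℤ; +_; -_; _+_; _≤_)
open import Data.Integer
  using (-[1+_]; _-_; _*_; _^_; _<_; _⊖_; ∣_∣; +≤+; NonNegative; nonNegative; +-*-rawRing)
import Data.Integer.Properties as ℤₚ
open import Data.Integer.Tactic.RingSolver using (solve-∀)
import Data.Maybe as Maybe
open import Data.Nat using (ℕ; zero; suc; z≤n)
import Data.Nat as ℕ
open import Data.Product using (_×_; ∃-syntax; _,_)
open import Data.Sum using (_⊎_; inj₁; inj₂)
open import Data.Unit using (⊤)
open import Data.Vec using (Vec; []; _∷_; lookup; map)
open import Data.Vec.Relation.Binary.Pointwise.Inductive as Pointwise using (Pointwise; []; _∷_)
open import Relation.Binary.Consequences using (dec⇒weaklyDec)
open import Relation.Binary.Definitions using (WeaklyDecidable)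
open import Relation.Binary.PropositionalEquality using (_≡_)
open import Relation.Binary.PropositionalEquality as ≡ using (cong; subst)
import Relation.Binary.Reasoning.Setoid as SetoidReasoning
open import Relation.Binary.Structures using (IsStrictPartialOrder)
open import Relation.Nullary using (¬_; contradiction)
open import Relation.Unary using (_∈_; _∪_; ｛_｝)

-- The product of p + qx + rx² over three values of x with elementary symmetric functions
-- e₁, e₂, e₃.
module _ {c ℓ} (R : RawRing c ℓ) where
  open RawRing R renaming (_+_ to _⊕_; _*_ to _⊗_; -_ to ⊝_)

  normForm : (e₁ e₂ e₃ p q r : Carrier) → Carrier
  normForm e₁ e₂ e₃ p q r =
    p ⊗ p ⊗ p
      ⊕ p ⊗ p ⊗ q ⊗ e₁
      ⊕ p ⊗ p ⊗ r ⊗ (e₁ ⊗ e₁ ⊕ ⊝ (e₂ ⊕ e₂))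
      ⊕ p ⊗ q ⊗ q ⊗ e₂
      ⊕ p ⊗ q ⊗ r ⊗ (e₁ ⊗ e₂ ⊕ ⊝ (e₃ ⊕ e₃ ⊕ e₃))
      ⊕ p ⊗ r ⊗ r ⊗ (e₂ ⊗ e₂ ⊕ ⊝ (e₁ ⊗ e₃ ⊕ e₁ ⊗ e₃))
      ⊕ q ⊗ q ⊗ q ⊗ e₃
      ⊕ q ⊗ q ⊗ r ⊗ (e₁ ⊗ e₃)
      ⊕ q ⊗ r ⊗ r ⊗ (e₂ ⊗ e₃)
      ⊕ r ⊗ r ⊗ r ⊗ (e₃ ⊗ e₃)

module PolynomialSolver {r₁ r₂ r₃ r₄}
  (Coeff : RawRing r₁ r₄) (R : AlmostCommutativeRing r₂ r₃)
  (morphism : Coeff -Raw-AlmostCommutative⟶ R)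
  (_≟_ : WeaklyDecidable (Induced-equivalence morphism)) where
  open RingSolver Coeff R morphism _≟_ public

  polynomialRing : ℕ → RawRing _ _
  polynomialRing n = record
    { Carrier = Polynomial n
    ; _≈_     = _≡_
    ; _+_     = _:+_
    ; _*_     = _:*_
    ; -_      = :-_
    ; 0#      = con (RawRing.0# Coeff)
    ; 1#      = con (RawRing.1# Coeff)
    }

normℤ : ℤ → ℤ[ρ] → ℤ
normℤ a ⟨ p , q , r ⟩ = normForm +-*-rawRing a (- (a + + 3)) (+ 1) p q r

≤⇒∃+ : ∀ {i j} → i ≤ j → ∃[ k ] j ≡ i + + k
≤⇒∃+ {i} {j} i≤j = ∣ j - i ∣ , (begin
  j                ≡⟨ i+[j-i]≡j i j ⟨
  i + (j - i)      ≡⟨ cong (λ k → i + k) (ℤₚ.0≤i⇒+∣i∣≡i (ℤₚ.i≤j⇒0≤j-i i≤j)) ⟨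
  i + + ∣ j - i ∣  ∎)
  where
  open ≡.≡-Reasoning
  i+[j-i]≡j : ∀ i j → i + (j - i) ≡ j
  i+[j-i]≡j = solve-∀

module _ {c ℓ₁ ℓ₂} (K : OrderedField c ℓ₁ ℓ₂) where
  open OrderedField K
    renaming (_+_ to _+ᴷ_; _*_ to _*ᴷ_; -_ to -ᴷ_; _-_ to _-ᴷ_; _<_ to _<ᴷ_; _≤_ to _≤ᴷ_)
  private
    open CommutativeRing commutativeRing using (ring; semiring; +-group; +-abelianGroup)
    module G = GroupProperties +-group
    open RingProperties ring using (-‿distribˡ-*; -‿distribʳ-*)
    open AbelianGroupProperties +-abelianGroup using (⁻¹-∙-comm)
    module Mult = SemiringMult semiring
    open Mult using (×-homo-+; ×1-homo-*) renaming (_×_ to _·_)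
    open SetoidReasoning setoid
    ι = fromℤ K

  fromℤ-⊖ : ∀ m n → ι (m ⊖ n) ≈ m · 1# -ᴷ n · 1#
  fromℤ-⊖ zero    zero    = sym (trans (+-congˡ G.ε⁻¹≈ε) (+-identityʳ 0#))
  fromℤ-⊖ zero    (suc n) = sym (+-identityˡ _)
  fromℤ-⊖ (suc m) zero    = sym (trans (+-congˡ G.ε⁻¹≈ε) (+-identityʳ _))
  fromℤ-⊖ (suc m) (suc n) = begin
    ι (suc m ⊖ suc n)                              ≡⟨ cong ι (ℤₚ.[1+m]⊖[1+n]≡m⊖n m n) ⟩
    ι (m ⊖ n)                                      ≈⟨ fromℤ-⊖ m n ⟩
    m · 1# -ᴷ n · 1#                               ≈⟨ +-congʳ (+-identityʳ _) ⟨
    m · 1# +ᴷ 0# -ᴷ n · 1#                         ≈⟨ +-congʳ (+-congˡ (-‿inverseʳ 1#)) ⟨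
    m · 1# +ᴷ (1# -ᴷ 1#) -ᴷ n · 1#                 ≈⟨ +-congʳ (+-assoc _ _ _) ⟨
    m · 1# +ᴷ 1# -ᴷ 1# -ᴷ n · 1#                   ≈⟨ +-assoc _ _ _ ⟩
    m · 1# +ᴷ 1# +ᴷ (-ᴷ 1# -ᴷ n · 1#)              ≈⟨ +-cong (+-comm _ _) (⁻¹-∙-comm 1# _) ⟩
    suc m · 1# -ᴷ suc n · 1#                       ∎

  fromℤ-homo-+ : ∀ i j → ι (i + j) ≈ ι i +ᴷ ι j
  fromℤ-homo-+ (+ m)    (+ n)    = ×-homo-+ 1# m n
  fromℤ-homo-+ (+ m)    -[1+ n ] = fromℤ-⊖ m (suc n)
  fromℤ-homo-+ -[1+ m ] (+ n)    = trans (fromℤ-⊖ n (suc m)) (+-comm _ _)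
  fromℤ-homo-+ -[1+ m ] -[1+ n ] = begin
    ι (-[1+ m ] + -[1+ n ])            ≡⟨ cong ι (ℤₚ.neg-distrib-+ (+ suc m) (+ suc n)) ⟨
    -ᴷ ((suc m ℕ.+ suc n) · 1#)        ≈⟨ -‿cong (×-homo-+ 1# (suc m) (suc n)) ⟩
    -ᴷ (suc m · 1# +ᴷ suc n · 1#)      ≈⟨ ⁻¹-∙-comm _ _ ⟨
    -ᴷ (suc m · 1#) -ᴷ suc n · 1#      ∎

  fromℤ-homo-neg : ∀ i → ι (- i) ≈ -ᴷ ι i
  fromℤ-homo-neg (+ zero)  = sym G.ε⁻¹≈ε
  fromℤ-homo-neg (+ suc n) = refl
  fromℤ-homo-neg -[1+ n ]  = sym (G.⁻¹-involutive _)

  fromℤ-homo-pos-* : ∀ m j → ι (+ m * j) ≈ ι (+ m) *ᴷ ι j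
  fromℤ-homo-pos-* m (+ n)    = trans (reflexive (cong ι (≡.sym (ℤₚ.pos-* m n)))) (×1-homo-* m n)
  fromℤ-homo-pos-* m -[1+ n ] = begin
    ι (+ m * -[1+ n ])           ≡⟨ cong ι (ℤₚ.neg-distribʳ-* (+ m) (+ suc n)) ⟨
    ι (- (+ m * + suc n))        ≈⟨ fromℤ-homo-neg (+ m * + suc n) ⟩
    -ᴷ ι (+ m * + suc n)         ≈⟨ -‿cong (fromℤ-homo-pos-* m (+ suc n)) ⟩
    -ᴷ (ι (+ m) *ᴷ ι (+ suc n))  ≈⟨ -‿distribʳ-* _ _ ⟩
    ι (+ m) *ᴷ ι -[1+ n ]        ∎

  fromℤ-homo-* : ∀ i j → ι (i * j) ≈ ι i *ᴷ ι j
  fromℤ-homo-* (+ m)    j = fromℤ-homo-pos-* m j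
  fromℤ-homo-* -[1+ m ] j = begin
    ι (-[1+ m ] * j)             ≡⟨ cong ι (ℤₚ.neg-distribˡ-* (+ suc m) j) ⟨
    ι (- (+ suc m * j))          ≈⟨ fromℤ-homo-neg (+ suc m * j) ⟩
    -ᴷ ι (+ suc m * j)           ≈⟨ -‿cong (fromℤ-homo-pos-* (suc m) j) ⟩
    -ᴷ (ι (+ suc m) *ᴷ ι j)      ≈⟨ -‿distribˡ-* _ _ ⟩
    ι -[1+ m ] *ᴷ ι j            ∎

  fromℤ-morphism : +-*-rawRing -Raw-AlmostCommutative⟶ fromCommutativeRing commutativeRing
  fromℤ-morphism = record
    { ⟦_⟧    = ι
    ; +-homo = fromℤ-homo-+
    ; *-homo = fromℤ-homo-*
    ; -‿homo = fromℤ-homo-neg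
    ; 0-homo = refl
    ; 1-homo = +-identityʳ 1#
    }

  -- Below, x :^ 0 stands for 1#, because con (+ 1) denotes 1# + 0#.
  module S = PolynomialSolver +-*-rawRing (fromCommutativeRing commutativeRing) fromℤ-morphism
    (λ i j → Maybe.map (λ i≡j → reflexive (cong ι i≡j)) (dec⇒weaklyDec ℤₚ._≟_ i j))

  ⟦_⟧ℤ : ∀ {n} → S.Polynomial n → Vec ℤ n → ℤ
  ⟦ S.op S.[+] P Q ⟧ℤ ns = ⟦ P ⟧ℤ ns + ⟦ Q ⟧ℤ ns
  ⟦ S.op S.[*] P Q ⟧ℤ ns = ⟦ P ⟧ℤ ns * ⟦ Q ⟧ℤ ns
  ⟦ S.con i ⟧ℤ ns        = i
  ⟦ S.var x ⟧ℤ ns        = lookup ns x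
  ⟦ P S.:^ k ⟧ℤ ns       = ⟦ P ⟧ℤ ns ^ k
  ⟦ S.:- P ⟧ℤ ns         = - ⟦ P ⟧ℤ ns

  fromℤ-⟦⟧ : ∀ {n} (P : S.Polynomial n) {ns xs} → Pointwise (λ i x → ι i ≈ x) ns xs →
             ι (⟦ P ⟧ℤ ns) ≈ S.⟦ P ⟧ xs
  fromℤ-⟦⟧ (S.op S.[+] P Q) eqs =
    trans (fromℤ-homo-+ (⟦ P ⟧ℤ _) _) (+-cong (fromℤ-⟦⟧ P eqs) (fromℤ-⟦⟧ Q eqs))
  fromℤ-⟦⟧ (S.op S.[*] P Q) eqs =
    trans (fromℤ-homo-* (⟦ P ⟧ℤ _) _) (*-cong (fromℤ-⟦⟧ P eqs) (fromℤ-⟦⟧ Q eqs))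
  fromℤ-⟦⟧ (S.con i) eqs        = refl
  fromℤ-⟦⟧ (S.var x) eqs        = Pointwise.lookup eqs x
  fromℤ-⟦⟧ (P S.:^ zero) eqs    = +-identityʳ 1#
  fromℤ-⟦⟧ (P S.:^ suc k) eqs   =
    trans (fromℤ-homo-* (⟦ P ⟧ℤ _) _) (*-cong (fromℤ-⟦⟧ P eqs) (fromℤ-⟦⟧ (P S.:^ k) eqs))
  fromℤ-⟦⟧ (S.:- P) eqs         = trans (fromℤ-homo-neg (⟦ P ⟧ℤ _)) (-‿cong (fromℤ-⟦⟧ P eqs))

  open IsStrictPartialOrder isStrictPartialOrder
    using (<-respʳ-≈; <-respˡ-≈) renaming (trans to <-trans)

  0<1+n·1 : 0# <ᴷ 1# → ∀ n → 0# <ᴷ suc n · 1#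
  0<1+n·1 0<1 zero    = <-respʳ-≈ (sym (+-identityʳ 1#)) 0<1
  0<1+n·1 0<1 (suc n) =
    <-trans (0<1+n·1 0<1 n) (<-respˡ-≈ (+-identityˡ _) (+-monoˡ-< (suc n · 1#) 0<1))

  fromℤ-mono-< : 0# <ᴷ 1# → ∀ {i j} → i < j → ι i <ᴷ ι j
  fromℤ-mono-< 0<1 {i} {j} i<j with ≤⇒∃+ (ℤₚ.i<j⇒suc[i]≤j i<j)
  ... | k , ≡.refl = <-respʳ-≈ (begin
    suc k · 1# +ᴷ ι i         ≈⟨ fromℤ-homo-+ (+ suc k) i ⟨
    ι (+ suc k + i)           ≡⟨ cong ι (shift i (+ k)) ⟩
    ι (+ 1 + i + + k)         ∎)
    (<-respˡ-≈ (+-identityˡ (ι i)) (+-monoˡ-< (ι i) (0<1+n·1 0<1 k)))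
    where
    shift : ∀ i k → + 1 + k + i ≡ + 1 + i + k
    shift = solve-∀

  #⇒*-cancelˡ-0 : ∀ {x y u} → x # y → (x -ᴷ y) *ᴷ u ≈ 0# → u ≈ 0#
  #⇒*-cancelˡ-0 {x} {y} {u} x#y xu≈0 with #⇒invertible x#y
  ... | i , i*[x-y]≈1 , _ = begin
    u                    ≈⟨ *-identityˡ u ⟨
    1# *ᴷ u              ≈⟨ *-congʳ i*[x-y]≈1 ⟨
    i *ᴷ (x -ᴷ y) *ᴷ u   ≈⟨ *-assoc _ _ _ ⟩
    i *ᴷ ((x -ᴷ y) *ᴷ u) ≈⟨ *-congˡ xu≈0 ⟩
    i *ᴷ 0#              ≈⟨ zeroʳ i ⟩
    0#                   ∎

  private
    cubicQuotient : ℤ → Carrier → Carrier → Carrier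
    cubicQuotient a x y = x *ᴷ x +ᴷ x *ᴷ y +ᴷ y *ᴷ y -ᴷ ι a *ᴷ (x +ᴷ y) -ᴷ ι (a + + 3)

    -ᴷ-zero : ∀ {x y} → x ≈ 0# → y ≈ 0# → x -ᴷ y ≈ 0#
    -ᴷ-zero x≈0 y≈0 = trans (+-cong x≈0 (-‿cong y≈0)) (-‿inverseʳ 0#)

  cubicQuotient-zero : ∀ a {x y} → x # y → cubic K a x ≈ 0# → cubic K a y ≈ 0# →
                       cubicQuotient a x y ≈ 0#
  cubicQuotient-zero a {x} {y} x#y fx≈0 fy≈0 = #⇒*-cancelˡ-0 x#y (begin
    (x -ᴷ y) *ᴷ cubicQuotient a x y  ≈⟨ factor x y (ι a) (ι (a + + 3)) ⟩
    cubic K a x -ᴷ cubic K a y       ≈⟨ -ᴷ-zero fx≈0 fy≈0 ⟩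
    0#                               ∎)
    where
    open S
    factor = solve 4 (λ x y a b →
      let f = λ x → x :* x :* x :- a :* (x :* x) :- b :* x :- x :^ 0 in
      (x :- y) :* (x :* x :+ x :* y :+ y :* y :- a :* (x :+ y) :- b) := f x :- f y) refl

  module Vieta (a : ℤ) {x y z : Carrier} (x#y : x # y) (x#z : x # z) (y#z : y # z)
           (fx≈0 : cubic K a x ≈ 0#) (fy≈0 : cubic K a y ≈ 0#) (fz≈0 : cubic K a z ≈ 0#) where

    e₁-a≈0 : x +ᴷ y +ᴷ z -ᴷ ι a ≈ 0#
    e₁-a≈0 = #⇒*-cancelˡ-0 y#z (begin
      (y -ᴷ z) *ᴷ (x +ᴷ y +ᴷ z -ᴷ ι a)           ≈⟨ factor x y z (ι a) (ι (a + + 3)) ⟩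
      cubicQuotient a x y -ᴷ cubicQuotient a x z
        ≈⟨ -ᴷ-zero (cubicQuotient-zero a x#y fx≈0 fy≈0) (cubicQuotient-zero a x#z fx≈0 fz≈0) ⟩
      0#                                         ∎)
      where
      open S
      factor = solve 5 (λ x y z a b →
        let q = λ x y → x :* x :+ x :* y :+ y :* y :- a :* (x :+ y) :- b in
        (y :- z) :* (x :+ y :+ z :- a) := q x y :- q x z) refl

    vieta₁ : ι a ≈ x +ᴷ y +ᴷ z
    vieta₁ = sym (G.x∙y⁻¹≈ε⇒x≈y _ _ e₁-a≈0)

    vieta₂ : ι (- (a + + 3)) ≈ x *ᴷ y +ᴷ x *ᴷ z +ᴷ y *ᴷ z
    vieta₂ = trans (fromℤ-homo-neg (a + + 3)) (G.x∙y⁻¹≈ε⇒x≈y _ _ (begin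
      -ᴷ ι (a + + 3) -ᴷ (x *ᴷ y +ᴷ x *ᴷ z +ᴷ y *ᴷ z)
        ≈⟨ rearrange x y z (ι a) (ι (a + + 3)) ⟩
      cubicQuotient a x y -ᴷ (x +ᴷ y) *ᴷ (x +ᴷ y +ᴷ z -ᴷ ι a)
        ≈⟨ -ᴷ-zero (cubicQuotient-zero a x#y fx≈0 fy≈0) (trans (*-congˡ e₁-a≈0) (zeroʳ _)) ⟩
      0# ∎))
      where
      open S
      rearrange = solve 5 (λ x y z a b →
        :- b :- (x :* y :+ x :* z :+ y :* z)
          := x :* x :+ x :* y :+ y :* y :- a :* (x :+ y) :- b :- (x :+ y) :* (x :+ y :+ z :- a)) refl

    vieta₃ : ι (+ 1) ≈ x *ᴷ y *ᴷ z
    vieta₃ = sym (G.x∙y⁻¹≈ε⇒x≈y _ _ (begin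
      x *ᴷ y *ᴷ z -ᴷ ι (+ 1)
        ≈⟨ rearrange x y z (ι a) (ι (a + + 3)) ⟩
      cubic K a x -ᴷ x *ᴷ (cubicQuotient a x y -ᴷ y *ᴷ (x +ᴷ y +ᴷ z -ᴷ ι a))
        ≈⟨ -ᴷ-zero fx≈0 (trans (*-congˡ (-ᴷ-zero (cubicQuotient-zero a x#y fx≈0 fy≈0)
             (trans (*-congˡ e₁-a≈0) (zeroʳ y)))) (zeroʳ x)) ⟩
      0# ∎))
      where
      open S
      rearrange = solve 5 (λ x y z a b →
        x :* y :* z :- con (+ 1)
          := x :* x :* x :- a :* (x :* x) :- b :* x :- x :^ 0
             :- x :* (x :* x :+ x :* y :+ y :* y :- a :* (x :+ y) :- b :- y :* (x :+ y :+ z :- a))) refl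

  norm-symmetric : ∀ x y z p q r →
    let e = λ t → p +ᴷ q *ᴷ t +ᴷ r *ᴷ (t *ᴷ t) in
    e x *ᴷ e y *ᴷ e z ≈
    normForm (CommutativeRing.rawRing commutativeRing)
      (x +ᴷ y +ᴷ z) (x *ᴷ y +ᴷ x *ᴷ z +ᴷ y *ᴷ z) (x *ᴷ y *ᴷ z) p q r
  norm-symmetric = S.solve 6 (λ x y z p q r →
    let e = λ t → p :+ q :* t :+ r :* (t :* t) in
    e x :* e y :* e z :=
    normForm (polynomialRing 6) (x :+ y :+ z) (x :* y :+ x :* z :+ y :* z) (x :* y :* z) p q r) refl
    where open S

  -- evalAt without its argument Roots K a, on which it does not depend.
  evalᴷ : Carrier → ℤ[ρ] → Carrier
  evalᴷ x ⟨ p , q , r ⟩ = ι p +ᴷ ι q *ᴷ x +ᴷ ι r *ᴷ (x *ᴷ x)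

  eval-add : ∀ x u w → evalᴷ x (add u w) ≈ evalᴷ x u +ᴷ evalᴷ x w
  eval-add x ⟨ p , q , r ⟩ ⟨ p′ , q′ , r′ ⟩ = begin
    ι (p + p′) +ᴷ ι (q + q′) *ᴷ x +ᴷ ι (r + r′) *ᴷ (x *ᴷ x)
      ≈⟨ +-cong (+-cong (fromℤ-homo-+ p p′) (*-congʳ (fromℤ-homo-+ q q′)))
           (*-congʳ (fromℤ-homo-+ r r′)) ⟩
    (ι p +ᴷ ι p′) +ᴷ (ι q +ᴷ ι q′) *ᴷ x +ᴷ (ι r +ᴷ ι r′) *ᴷ (x *ᴷ x)
      ≈⟨ expand x (ι p) (ι q) (ι r) (ι p′) (ι q′) (ι r′) ⟩
    (ι p +ᴷ ι q *ᴷ x +ᴷ ι r *ᴷ (x *ᴷ x)) +ᴷ (ι p′ +ᴷ ι q′ *ᴷ x +ᴷ ι r′ *ᴷ (x *ᴷ x)) ∎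
    where
    open S
    expand = solve 7 (λ x p q r p′ q′ r′ →
      (p :+ p′) :+ (q :+ q′) :* x :+ (r :+ r′) :* (x :* x) :=
      (p :+ q :* x :+ r :* (x :* x)) :+ (p′ :+ q′ :* x :+ r′ :* (x :* x))) refl

  eval-scale : ∀ x k u → evalᴷ x (scale k u) ≈ ι k *ᴷ evalᴷ x u
  eval-scale x k ⟨ p , q , r ⟩ = begin
    ι (k * p) +ᴷ ι (k * q) *ᴷ x +ᴷ ι (k * r) *ᴷ (x *ᴷ x)
      ≈⟨ +-cong (+-cong (fromℤ-homo-* k p) (*-congʳ (fromℤ-homo-* k q)))
           (*-congʳ (fromℤ-homo-* k r)) ⟩
    ι k *ᴷ ι p +ᴷ ι k *ᴷ ι q *ᴷ x +ᴷ ι k *ᴷ ι r *ᴷ (x *ᴷ x)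
      ≈⟨ expand x (ι k) (ι p) (ι q) (ι r) ⟩
    ι k *ᴷ (ι p +ᴷ ι q *ᴷ x +ᴷ ι r *ᴷ (x *ᴷ x)) ∎
    where
    open S
    expand = solve 5 (λ x k p q r →
      k :* p :+ k :* q :* x :+ k :* r :* (x :* x) := k :* (p :+ q :* x :+ r :* (x :* x))) refl

  module _ (a : ℤ) {x : Carrier} (fx≈0 : cubic K a x ≈ 0#) where

    eval-ρ· : ∀ u → evalᴷ x ((ρ·_) a u) ≈ x *ᴷ evalᴷ x u
    eval-ρ· ⟨ p , q , r ⟩ = begin
      ι r +ᴷ ι (p + (a + + 3) * r) *ᴷ x +ᴷ ι (q + a * r) *ᴷ (x *ᴷ x)
        ≈⟨ +-cong (+-congˡ (*-congʳ
               (trans (fromℤ-homo-+ p _) (+-congˡ (fromℤ-homo-* (a + + 3) r)))))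
             (*-congʳ (trans (fromℤ-homo-+ q _) (+-congˡ (fromℤ-homo-* a r)))) ⟩
      ι r +ᴷ (ι p +ᴷ ι (a + + 3) *ᴷ ι r) *ᴷ x +ᴷ (ι q +ᴷ ι a *ᴷ ι r) *ᴷ (x *ᴷ x)
        ≈⟨ reduce x (ι a) (ι (a + + 3)) (ι p) (ι q) (ι r) ⟩
      x *ᴷ evalᴷ x ⟨ p , q , r ⟩ -ᴷ ι r *ᴷ cubic K a x
        ≈⟨ +-congˡ (-‿cong (trans (*-congˡ fx≈0) (zeroʳ (ι r)))) ⟩
      x *ᴷ evalᴷ x ⟨ p , q , r ⟩ -ᴷ 0#
        ≈⟨ trans (+-congˡ G.ε⁻¹≈ε) (+-identityʳ _) ⟩
      x *ᴷ evalᴷ x ⟨ p , q , r ⟩ ∎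
      where
      open S
      reduce = solve 6 (λ x a b p q r →
        r :+ (p :+ b :* r) :* x :+ (q :+ a :* r) :* (x :* x) :=
        x :* (p :+ q :* x :+ r :* (x :* x))
          :- r :* (x :* x :* x :- a :* (x :* x) :- b :* x :- x :^ 0)) refl

    eval-mul : ∀ u w → evalᴷ x (mul a u w) ≈ evalᴷ x u *ᴷ evalᴷ x w
    eval-mul u@(⟨ p , q , r ⟩) w = begin
      evalᴷ x (mul a u w)
        ≈⟨ eval-add x (scale p w) ((ρ·_) a qw+ρrw) ⟩
      evalᴷ x (scale p w) +ᴷ evalᴷ x ((ρ·_) a qw+ρrw)
        ≈⟨ +-cong (eval-scale x p w) (trans (eval-ρ· qw+ρrw)
             (*-congˡ (eval-add x (scale q w) ((ρ·_) a (scale r w))))) ⟩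
      ι p *ᴷ evalᴷ x w +ᴷ x *ᴷ (evalᴷ x (scale q w) +ᴷ evalᴷ x ((ρ·_) a (scale r w)))
        ≈⟨ +-congˡ (*-congˡ (+-cong (eval-scale x q w)
             (trans (eval-ρ· (scale r w)) (*-congˡ (eval-scale x r w))))) ⟩
      ι p *ᴷ evalᴷ x w +ᴷ x *ᴷ (ι q *ᴷ evalᴷ x w +ᴷ x *ᴷ (ι r *ᴷ evalᴷ x w))
        ≈⟨ factor x (ι p) (ι q) (ι r) (evalᴷ x w) ⟩
      evalᴷ x u *ᴷ evalᴷ x w ∎
      where
      open S
      qw+ρrw = add (scale q w) ((ρ·_) a (scale r w))
      factor = solve 5 (λ x p q r w →
        p :* w :+ x :* (q :* w :+ x :* (r :* w)) := (p :+ q :* x :+ r :* (x :* x)) :* w) refl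

  module _ {a : ℤ} (R : Roots K a) where
    open Roots R

    norm-mul : ∀ u w → norm K R (mul a u w) ≈ norm K R u *ᴷ norm K R w
    norm-mul u w = trans
      (*-cong (*-cong (eval-mul a ρ-root u w) (eval-mul a ρ′-root u w)) (eval-mul a ρ″-root u w))
      (solve 6 (λ x y z x′ y′ z′ →
         x :* x′ :* (y :* y′) :* (z :* z′) := x :* y :* z :* (x′ :* y′ :* z′)) refl _ _ _ _ _ _)
      where open S

    0<1 : 0# <ᴷ 1#
    0<1 = <-respˡ-≈ (solve 0 (con (- + 2) :+ con (+ 2) := con (+ 0)) refl)
         (<-respʳ-≈ (solve 1 (λ x → con (- + 1) :+ con (+ 2) := x :^ 0) refl 0#)
           (+-monoˡ-< (ι (+ 2)) (<-trans -2<ρ′ ρ′<-1)))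
      where open S

    module _ (0≤a : + 0 ≤ a) where
      ρ″<ρ : ρ″ <ᴷ ρ
      ρ″<ρ = <-trans ρ″<0 (<-trans (fromℤ-mono-< 0<1 0<a+1) a+1<ρ)
        where
        0<a+1 : + 0 < a + + 1
        0<a+1 = ℤₚ.suc[i]≤j⇒i<j (ℤₚ.+-monoˡ-≤ (+ 1) 0≤a)

      ρ′<ρ″ : ρ′ <ᴷ ρ″
      ρ′<ρ″ = <-trans ρ′<-1 -1<ρ″

      norm≈fromℤ : ∀ u → norm K R u ≈ ι (normℤ a u)
      norm≈fromℤ ⟨ p , q , r ⟩ = trans
        (norm-symmetric ρ ρ′ ρ″ (ι p) (ι q) (ι r))
        (sym (fromℤ-⟦⟧
          (normForm (S.polynomialRing 6)
            (S.var 0F) (S.var 1F) (S.var 2F) (S.var 3F) (S.var 4F) (S.var 5F))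
          {a ∷ - (a + + 3) ∷ + 1 ∷ p ∷ q ∷ r ∷ []}
          (vieta₁ ∷ vieta₂ ∷ vieta₃ ∷ refl ∷ refl ∷ refl ∷ [])))
        where
        ρ#ρ′ = #-sym (<⇒# (<-trans ρ′<ρ″ ρ″<ρ))
        ρ#ρ″ = #-sym (<⇒# ρ″<ρ)
        ρ′#ρ″ = <⇒# ρ′<ρ″
        open Vieta a ρ#ρ′ ρ#ρ″ ρ′#ρ″ ρ-root ρ′-root ρ″-root

      norm-square-≤⇒normℤ : ∀ u w → norm K R (square a u) ≤ᴷ norm K R w →
                            normℤ a u * normℤ a u ≤ normℤ a w
      norm-square-≤⇒normℤ u w Nu²≤Nw = ℤₚ.≮⇒≥ λ nw<nu² → Nu²≤Nw
        (<-respˡ-≈ (sym (norm≈fromℤ w)) (<-respʳ-≈ (begin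
          ι (normℤ a u * normℤ a u)         ≈⟨ fromℤ-homo-* (normℤ a u) (normℤ a u) ⟩
          ι (normℤ a u) *ᴷ ι (normℤ a u)    ≈⟨ *-cong (norm≈fromℤ u) (norm≈fromℤ u) ⟨
          norm K R u *ᴷ norm K R u          ≈⟨ norm-mul u u ⟨
          norm K R (square a u)             ∎) (fromℤ-mono-< 0<1 nw<nu²)))

module Z = PolynomialSolver +-*-rawRing (fromCommutativeRing ℤₚ.+-*-commutativeRing)
  (-raw-almostCommutative⟶ _) (dec⇒weaklyDec ℤₚ._≟_)

-- Computes on closed polynomials, so that an inequality between polynomials over ℕ is
-- settled by normalising their difference.
mutual
  NonNegCoeffsᴴ : ∀ {n} → Z.HNF (suc n) → Set
  NonNegCoeffsᴴ Z.∅         = ⊤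
  NonNegCoeffsᴴ (P Z.*x+ Q) = NonNegCoeffsᴴ P × NonNegCoeffs Q

  NonNegCoeffs : ∀ {n} → Z.Normal n → Set
  NonNegCoeffs (Z.con i)  = NonNegative i
  NonNegCoeffs (Z.poly P) = NonNegCoeffsᴴ P

mutual
  ⟦⟧ᴴ-nonNeg : ∀ {n} (P : Z.HNF (suc n)) → NonNegCoeffsᴴ P → ∀ ns → + 0 ≤ Z.⟦ P ⟧H (map +_ ns)
  ⟦⟧ᴴ-nonNeg Z.∅         _       (n ∷ ns) = ℤₚ.≤-refl
  ⟦⟧ᴴ-nonNeg (P Z.*x+ Q) (p , q) (n ∷ ns) =
    ℤₚ.+-mono-≤ (ℤₚ.*-monoʳ-≤-nonNeg (+ n) (⟦⟧ᴴ-nonNeg P p (n ∷ ns))) (⟦⟧-nonNeg Q q ns)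

  ⟦⟧-nonNeg : ∀ {n} (P : Z.Normal n) → NonNegCoeffs P → ∀ ns → + 0 ≤ Z.⟦ P ⟧N (map +_ ns)
  ⟦⟧-nonNeg (Z.con i)  p _  = ℤₚ.nonNegative⁻¹ i {{p}}
  ⟦⟧-nonNeg (Z.poly P) p ns = ⟦⟧ᴴ-nonNeg P p ns

≤-by-coeffs : ∀ {n} (P Q : Z.Polynomial n) → {NonNegCoeffs (Z.normalise (Q Z.:- P))} →
              ∀ ns → Z.⟦ P ⟧ (map +_ ns) ≤ Z.⟦ Q ⟧ (map +_ ns)
≤-by-coeffs P Q {nonNeg} ns =
  ℤₚ.0≤i-j⇒j≤i (subst (+ 0 ≤_) (Z.correct (Q Z.:- P) (map +_ ns))
    (⟦⟧-nonNeg (Z.normalise (Q Z.:- P)) nonNeg ns))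

open Z using (Polynomial; var; con; _:+_; _:*_; _:-_; :-_)

normᴾ : ∀ {n} (a p q r : Polynomial n) → Polynomial n
normᴾ a = normForm (Z.polynomialRing _) a (:- (a :+ con (+ 3))) (con (+ 1))

norm-αᴾ : ∀ {n} (a v W : Polynomial n) → Polynomial n
norm-αᴾ a v W = normᴾ a (:- v) (:- (v :* (a :+ con (+ 2)) :+ con (+ 1) :+ W)) (v :+ con (+ 1))

-- N(α(1,2))
bound : ℤ → ℤ
bound a = + 3 * a * a + + 9 * a - + 37

boundᴾ : ∀ {n} → Polynomial n → Polynomial n
boundᴾ a = con (+ 3) :* a :* a :+ con (+ 9) :* a :- con (+ 37)

norm-γ<bound² : ∀ {a} → + 15 ≤ a → normℤ a (γ a) < bound a * bound a
norm-γ<bound² 15≤a with ≤⇒∃+ 15≤a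
... | n , ≡.refl = ℤₚ.suc[i]≤j⇒i<j (≤-by-coeffs
    (con (+ 1) :+ normᴾ a (a :* a :+ a :+ con (+ 8)) (a :* a :- a :+ con (+ 1)) (con (+ 2) :- a))
    (boundᴾ a :* boundᴾ a) (n ∷ []))
  where a = con (+ 15) :+ var {1} 0F

0≤bound : ∀ {a} → + 15 ≤ a → + 0 ≤ bound a
0≤bound 15≤a with ≤⇒∃+ 15≤a
... | n , ≡.refl = ≤-by-coeffs (con (+ 0)) (boundᴾ (con (+ 15) :+ var {1} 0F)) (n ∷ [])

bound≤norm⇒norm²≰norm-γ : ∀ {a} → + 15 ≤ a → ∀ α → bound a ≤ normℤ a α →
                          ¬ (normℤ a α * normℤ a α ≤ normℤ a (γ a))
bound≤norm⇒norm²≰norm-γ {a} 15≤a α b≤N = ℤₚ.<⇒≱ (ℤₚ.<-≤-trans (norm-γ<bound² 15≤a) (begin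
  bound a * bound a      ≤⟨ ℤₚ.*-monoˡ-≤-nonNeg (bound a) {{nonNegative 0≤b}} b≤N ⟩
  bound a * normℤ a α    ≤⟨ ℤₚ.*-monoʳ-≤-nonNeg (normℤ a α) {{nonNegative (ℤₚ.≤-trans 0≤b b≤N)}} b≤N ⟩
  normℤ a α * normℤ a α  ∎))
  where
  open ℤₚ.≤-Reasoning
  0≤b = 0≤bound 15≤a

bound≤norm-α⟨1+v,2+v+s⟩ : ∀ v s t →
  let v′ = + 1 + + v; W = v′ + (+ 1 + + s); a = W + + 2 * v′ + + 1 + + t in
  bound a ≤ normℤ a (α⟨_,_⟩ a v′ W)
bound≤norm-α⟨1+v,2+v+s⟩ v s t = ≤-by-coeffs (boundᴾ a) (norm-αᴾ a v′ W) (v ∷ s ∷ t ∷ [])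
  where
  v′ = con (+ 1) :+ var {3} 0F
  W  = v′ :+ (con (+ 1) :+ var 1F)
  a  = W :+ con (+ 2) :* v′ :+ con (+ 1) :+ var 2F

bound≤norm-α⟨2+v,2+v⟩ : ∀ v t →
  let v′ = + 2 + + v; W = v′ + + 0; a = W + + 2 * v′ + + 1 + + t in
  bound a ≤ normℤ a (α⟨_,_⟩ a v′ W)
bound≤norm-α⟨2+v,2+v⟩ v t = ≤-by-coeffs (boundᴾ a) (norm-αᴾ a v′ W) (v ∷ t ∷ [])
  where
  v′ = con (+ 2) :+ var {2} 0F
  W  = v′ :+ con (+ 0)
  a  = W :+ con (+ 2) :* v′ :+ con (+ 1) :+ var 1F

bound≤norm-α⟨A,A⟩ : ∀ {A} → + 15 ≤ + 3 * A + + 0 →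
  let a = + 3 * A + + 0 in bound a ≤ normℤ a (α⟨_,_⟩ a A A)
bound≤norm-α⟨A,A⟩ {A} 15≤3A
  with ≤⇒∃+ (ℤₚ.*-cancelˡ-≤-pos (+ 5) A (+ 3) (subst (+ 15 ≤_) (ℤₚ.+-identityʳ (+ 3 * A)) 15≤3A))
... | n , ≡.refl = ≤-by-coeffs (boundᴾ a) (norm-αᴾ a A′ A′) (n ∷ [])
  where
  A′ = con (+ 5) :+ var {1} 0F
  a  = con (+ 3) :* A′ :+ con (+ 0)

W≤a-2v-1⇒a≡W+2v+1+t : ∀ a v W → W ≤ a - + 2 * v - + 1 → ∃[ t ] a ≡ W + + 2 * v + + 1 + + t
W≤a-2v-1⇒a≡W+2v+1+t a v W W≤ with ≤⇒∃+ W≤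
... | t , eq = t , ≡.trans (split a v) (≡.trans (cong (_+ (+ 2 * v + + 1)) eq) (regroup W v (+ t)))
  where
  split : ∀ a v → a ≡ a - + 2 * v - + 1 + (+ 2 * v + + 1)
  split = solve-∀
  regroup : ∀ W v t → W + t + (+ 2 * v + + 1) ≡ W + + 2 * v + + 1 + t
  regroup = solve-∀

Listed : ℤ → ℤ[ρ] → Set
Listed a = (λ x → ∃[ w ] (+ 1 ≤ w × w ≤ a × x ≡ ⟨ + 0 , - w , + 1 ⟩))
  ∪ (｛ ⟨ + 1 , + 1 , + 1 ⟩ ｝ ∪ ｛ ⟨ - (+ 1) , - (a + + 4) , + 2 ⟩ ｝)

rows≤⇒listed⊎bound≤norm : ∀ {a n x} → x ∈ rows≤ a n → Listed a x ⊎ bound a ≤ normℤ a x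
rows≤⇒listed⊎bound≤norm {a} (v , W , 0≤v , _ , v≤W , W≤ , ≡.refl)
  with ≤⇒∃+ 0≤v | ≤⇒∃+ v≤W | W≤a-2v-1⇒a≡W+2v+1+t a v W W≤
... | zero , ≡.refl | s , ≡.refl | t , ≡.refl =
  inj₁ (inj₁ (+ 1 + + s ,
    ≤-by-coeffs (con (+ 1)) (con (+ 1) :+ var {1} 0F) (s ∷ []) ,
    ≤-by-coeffs (con (+ 1) :+ var {2} 0F)
      (con (+ 0) :+ var 0F :+ con (+ 0) :+ con (+ 1) :+ var 1F) (s ∷ t ∷ []) ,
    ≡.refl))
... | suc v , ≡.refl | suc s , ≡.refl | t , ≡.refl = inj₂ (bound≤norm-α⟨1+v,2+v+s⟩ v s t)
... | suc (suc v) , ≡.refl | zero , ≡.refl | t , ≡.refl = inj₂ (bound≤norm-α⟨2+v,2+v⟩ v t)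
... | suc zero , ≡.refl | zero , ≡.refl | t , ≡.refl =
  inj₁ (inj₂ (inj₂ (cong (λ q → ⟨ - + 1 , q , + 2 ⟩) (coeff₁ (+ 4 + + t)))))
  where
  coeff₁ : ∀ a → - (a + + 4) ≡ - (+ 1 * (a + + 2) + + 1 + + 1)
  coeff₁ = solve-∀

▲₀⇒listed⊎bound≤norm : ∀ {a x} → + 15 ≤ a → x ∈ ▲₀ a → Listed a x ⊎ bound a ≤ normℤ a x
▲₀⇒listed⊎bound≤norm 15≤a (A , a₀ , ≡.refl , inj₁ (_ , x∈rows)) =
  rows≤⇒listed⊎bound≤norm x∈rows
▲₀⇒listed⊎bound≤norm 15≤a (A , a₀ , ≡.refl , inj₂ (_ , inj₁ x∈rows)) =
  rows≤⇒listed⊎bound≤norm x∈rows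
▲₀⇒listed⊎bound≤norm 15≤a (A , a₀ , ≡.refl , inj₂ (≡.refl , inj₂ ≡.refl)) =
  inj₂ (bound≤norm-α⟨A,A⟩ {A} 15≤a)

lemma3p2 : ∀ {c ℓ₁ ℓ₂} (K : OrderedField c ℓ₁ ℓ₂) (a : ℤ) → + 15 ≤ a →
    (R : Roots K a) (α : ℤ[ρ]) →
    α ∈ ▲₀ a ∪ ｛ ⟨ + 1 , + 1 , + 1 ⟩ ｝ →
    OrderedField._≤_ K (norm K R (square a α)) (norm K R (γ a)) →
    α ∈ (λ x → ∃[ w ] (+ 1 ≤ w × w ≤ a × x ≡ ⟨ + 0 , - w , + 1 ⟩))
        ∪ (｛ ⟨ + 1 , + 1 , + 1 ⟩ ｝ ∪ ｛ ⟨ - (+ 1) , - (a + + 4) , + 2 ⟩ ｝)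
lemma3p2 K a 15≤a R α (inj₂ α≡) _ = inj₂ (inj₁ α≡)
lemma3p2 K a 15≤a R α (inj₁ α∈▲₀) Nα²≤Nγ with ▲₀⇒listed⊎bound≤norm 15≤a α∈▲₀
... | inj₁ listed = listed
... | inj₂ b≤N    = contradiction
  (norm-square-≤⇒normℤ K R (ℤₚ.≤-trans (+≤+ z≤n) 15≤a) α (γ a) Nα²≤Nγ)
  (bound≤norm⇒norm²≰norm-γ 15≤a α b≤N)
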